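{- Let $n\ge2$ and $\pi,\tau\in S_n$. Then $\pi\sim\tau$ if and only if there exists $\sigma\in S_{n-1}$ such that $\{(\sigma(S^\pi_m),\varepsilon^\pi_m):1\le m\le n-1\}=\{(S^\tau_m,\varepsilon^\tau_m):1\le m\le n-1\}$ as sets, where $\sigma(S)=\{\sigma(j):j\in S\}$.
   Context: For $x=(x_1,\dots,x_{n-1})\in\mathbb{R}^{n-1}$ put $Z_0=0$ and $Z_i=x_1+\dots+x_i$. If $Z_0,\dots,Z_{n-1}$ are pairwise distinct, let $p(x)\in S_n$ be the permutation with the same relative order as $(Z_0,\dots,Z_{n-1})$, i.e. $p(x)(i)=|\{k: Z_k\le Z_{i-1}\}|$; otherwise $p(x)$ is undefined (and "$p(x)=\pi$" is false). Write $\pi\sim\tau$ if there is $\rho\in S_{n-1}$ such that for all $x\in\mathbb{R}^{n-1}$: $p(x_1,\dots,x_{n-1})=\pi$ iff $p(x_{\rho(1)},\dots,x_{\rho(n-1)})=\tau$. Edge data ("edge diagram"): for $\pi\in S_n$ and $1\le m\le n-1$, let $S^\pi_m=\{j\in\{1,\dots,n-1\}:\min(\pi(m),\pi(m+1))\le j<\max(\pi(m),\pi(m+1))\}$ (the set of "levels" covered by the $m$-th edge) and $\varepsilon^\pi_m=\operatorname{sgn}(\pi(m+1)-\pi(m))$.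
   Formalization: In the definition of π∼τ the vectors x range over ℚ^(n-1) rather than $\mathbb{R}^{n-1}$. -}

module Defs where

open import Data.Nat as ℕ using (ℕ; zero; suc)
open import Data.Fin as Fin using (Fin; zero; suc; toℕ; inject₁)
open import Data.Fin.Permutation using (Permutation′; _⟨$⟩ʳ_; _⟨$⟩ˡ_)
open import Data.Rational as ℚ using (ℚ; 0ℚ; _+_; _<_)
open import Data.Sign using (Sign)
open import Data.Bool using (true; false)
open import Data.Product using (_×_; Σ; ∃; ∃-syntax; _,_)
open import Function.Bundles using (_⇔_)
open import Relation.Nullary.Decidable using (does)
open import Relation.Binary.PropositionalEquality using (_≡_)

-- Partial sums: Z x i = x₁ + … + x_i (0-based: Z x zero = Z₀ = 0).
Z : ∀ {N} → (Fin N → ℚ) → Fin (suc N) → ℚ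
Z x zero = 0ℚ
Z {suc N} x (suc i) = x zero + Z (λ j → x (suc j)) i

-- p(x) = π : (Z₀,…,Z_{n-1}) has the same relative order as (π(1),…,π(n)).
-- (This forces the Z_i to be pairwise distinct, as π is injective.)
_has-pattern_ : ∀ {N} → (Fin N → ℚ) → Permutation′ (suc N) → Set
_has-pattern_ {N} x π =
  ∀ (i k : Fin (suc N)) → (Z x i < Z x k) ⇔ ((π ⟨$⟩ʳ i) Fin.< (π ⟨$⟩ʳ k))

-- π ∼ τ  (n = suc N, ρ ∈ S_{n-1} acts on coordinates: (x ∘ ρ)_i = x_{ρ(i)})
_∼_ : ∀ {N} → Permutation′ (suc N) → Permutation′ (suc N) → Set
_∼_ {N} π τ = ∃[ ρ ] ∀ (x : Fin N → ℚ) →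
  (x has-pattern π) ⇔ ((λ i → x (ρ ⟨$⟩ʳ i)) has-pattern τ)

-- Subsets of the levels {1,…,n-1}, level j represented by index j-1 : Fin N.
Levels : ℕ → Set₁
Levels N = Fin N → Set

-- S^π_m (edge m ∈ {1..n-1} represented by m-1 : Fin N):
-- level j-1 = t ∈ S iff min(π m, π (m+1)) ≤ j < max(..), in 0-based values
-- min(a,b) ≤ t < max(a,b) where a = π(m)-1, b = π(m+1)-1.
S : ∀ {N} → Permutation′ (suc N) → Fin N → Levels N
S π m t =
  let a = toℕ (π ⟨$⟩ʳ inject₁ m)
      b = toℕ (π ⟨$⟩ʳ suc m)
  in (ℕ._⊓_ a b ℕ.≤ toℕ t) × (toℕ t ℕ.< ℕ._⊔_ a b)

-- ε^π_m = sgn(π(m+1) - π(m))  (never 0 since π injective)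
ε : ∀ {N} → Permutation′ (suc N) → Fin N → Sign
ε π m with does ((π ⟨$⟩ʳ inject₁ m) Fin.<? (π ⟨$⟩ʳ suc m))
... | true = Sign.+
... | false = Sign.-

-- σ(S) = {σ(j) : j ∈ S}
image : ∀ {N} → Permutation′ N → Levels N → Levels N
image σ A j = Σ (Fin _) λ i → A i × (σ ⟨$⟩ʳ i ≡ j)

-- equality of subsets
_≐_ : ∀ {N} → Levels N → Levels N → Set
A ≐ B = ∀ j → A j ⇔ B j

-- {(σ(S^π_m), ε^π_m) : m} = {(S^τ_m, ε^τ_m) : m} as sets
EdgeSetsMatch : ∀ {N} → Permutation′ N → Permutation′ (suc N) → Permutation′ (suc N) → Set
EdgeSetsMatch {N} σ π τ =
  (∀ (m : Fin N) → ∃[ m′ ] (image σ (S π m) ≐ S τ m′) × (ε π m ≡ ε τ m′)) ×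
  (∀ (m′ : Fin N) → ∃[ m ] (image σ (S π m) ≐ S τ m′) × (ε π m ≡ ε τ m′))

{-# OPTIONS --safe #-}

-- The step vectors x with p(x) = π are exactly the vectors steps π y with positive gap vectors y,
-- where steps π is a linear isomorphism whose matrix has as m-th row ε^π_m times the indicator of
-- S^π_m. If ρ witnesses π ∼ τ, then steps τ⁻¹ ∘ Pᵨ ∘ steps π and its inverse preserve the positive
-- orthant, so this map is a permutation matrix times a positive diagonal matrix; since all entries of
-- the step matrices are 0 or ±1, the diagonal is 1, i.e. the rows of the two step matrices, which
-- encode the edge data, agree up to ρ and σ. Conversely, a matching of the edge data is a bijection ρ
-- of rows, since the rows of an invertible matrix are distinct, and the resulting matrix identity
-- carries the pattern cone of π onto that of τ.

module Submission where

open import Defs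
open import Data.Nat as ℕ using (ℕ; zero; suc; _≤_)
import Data.Nat.Properties as ℕP
open import Data.Fin as Fin using (Fin; zero; suc; toℕ; inject₁; fromℕ<)
import Data.Fin.Properties as FinP
open import Data.Fin.Permutation as Perm using (Permutation′; _⟨$⟩ʳ_; _⟨$⟩ˡ_)
open import Data.Rational as ℚ using (ℚ; 0ℚ; 1ℚ; _+_; _*_; -_; _-_; _<_) renaming (_≤_ to _≤ℚ_)
import Data.Rational.Properties as ℚP
open import Data.Rational.Solver using (module +-*-Solver)
open import Algebra.Properties.CommutativeMonoid.Sum ℚP.+-0-commutativeMonoid
  using (sum; sum-cong-≗; sum-permute; sum-replicate-zero)
open import Data.Sign using (Sign)
open import Data.Bool using (if_then_else_)
open import Data.Product using (_×_; ∃-syntax; _,_; proj₁; proj₂)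
open import Data.Empty using (⊥-elim)
open import Data.Vec.Functional using (Vector)
open import Function.Base using (_∘_)
open import Function.Bundles using (_⇔_; mk⇔; Equivalence; Injection)
open import Function.Properties.Inverse using (↔⇒↣)
import Function.Properties.Equivalence as ⇔
open import Relation.Binary.Definitions using (tri<; tri≈; tri>)
open import Relation.Nullary using (¬_; Dec; yes; no; does)
open import Relation.Nullary.Decidable using (dec-true; dec-false; decidable-stable; _×-dec_)
open import Relation.Binary.PropositionalEquality
  using (_≡_; _≢_; refl; sym; trans; cong; cong₂; subst; subst₂; _≗_; module ≡-Reasoning)
open +-*-Solver

private
  variable
    N : ℕ
    p q : ℚ

0≤* : 0ℚ ≤ℚ p → 0ℚ ≤ℚ q → 0ℚ ≤ℚ p * q
0≤* {p} {q} 0≤p 0≤q = ℚP.nonNegative⁻¹ (p * q)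
  {{ℚP.nonNeg*nonNeg⇒nonNeg p {{ℚ.nonNegative 0≤p}} q {{ℚ.nonNegative 0≤q}}}}

0≤∧≢0⇒0< : 0ℚ ≤ℚ p → p ≢ 0ℚ → 0ℚ < p
0≤∧≢0⇒0< {p} 0≤p p≢0 with p ℚP.≤? 0ℚ
... | yes p≤0 = ⊥-elim (p≢0 (ℚP.≤-antisym p≤0 0≤p))
... | no p≰0 = ℚP.≰⇒> p≰0

p<q⇒0<q-p : p < q → 0ℚ < q - p
p<q⇒0<q-p {p = p} {q = q} p<q = subst (_< q - p) (ℚP.+-inverseʳ p) (ℚP.+-monoˡ-< (- p) p<q)

p≤q⇒0≤q-p : p ≤ℚ q → 0ℚ ≤ℚ q - p
p≤q⇒0≤q-p {p = p} {q = q} p≤q = subst (_≤ℚ q - p) (ℚP.+-inverseʳ p) (ℚP.+-monoˡ-≤ (- p) p≤q)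

0≤q-p⇒p≤q : 0ℚ ≤ℚ q - p → p ≤ℚ q
0≤q-p⇒p≤q {q = q} {p = p} 0≤q-p =
  subst₂ _≤ℚ_ (ℚP.+-identityˡ p) (solve 2 (λ q p → (q :- p) :+ p := q) refl q p) (ℚP.+-monoˡ-≤ p 0≤q-p)

¬0<-1 : ¬ (0ℚ < - 1ℚ)
¬0<-1 (ℚ.*<* ())

-- Linear automorphisms of the positive orthant

AllPositive AllNonNegative : Vector ℚ N → Set
AllPositive y = ∀ j → 0ℚ < y j
AllNonNegative y = ∀ j → 0ℚ ≤ℚ y j

infixl 6 _+ᵥ_
infixr 7 _·ᵥ_

_+ᵥ_ : Vector ℚ N → Vector ℚ N → Vector ℚ N
(u +ᵥ v) i = u i + v i

_·ᵥ_ : ℚ → Vector ℚ N → Vector ℚ N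
(c ·ᵥ u) i = c * u i

0ᵥ 1ᵥ : Vector ℚ N
0ᵥ _ = 0ℚ
1ᵥ _ = 1ℚ

e : Fin N → Vector ℚ N
e zero    zero    = 1ℚ
e zero    (suc _) = 0ℚ
e (suc j) zero    = 0ℚ
e (suc j) (suc i) = e j i

e-diag : ∀ (j : Fin N) → e j j ≡ 1ℚ
e-diag zero    = refl
e-diag (suc j) = e-diag j

e-off : ∀ {i j : Fin N} → i ≢ j → e j i ≡ 0ℚ
e-off {i = zero}  {zero}  i≢j = ⊥-elim (i≢j refl)
e-off {i = zero}  {suc j} i≢j = refl
e-off {i = suc i} {zero}  i≢j = refl
e-off {i = suc i} {suc j} i≢j = e-off (i≢j ∘ cong suc)

e-nonNegative : ∀ (j : Fin N) → AllNonNegative (e j)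
e-nonNegative j i with i FinP.≟ j
... | yes refl = subst (0ℚ ≤ℚ_) (sym (e-diag j)) (ℚP.<⇒≤ (ℚP.positive⁻¹ 1ℚ))
... | no i≢j   = ℚP.≤-reflexive (sym (e-off i≢j))

supported-at-one-point : ∀ {v : Vector ℚ N} {k} → (∀ i → i ≢ k → v i ≡ 0ℚ) → v ≗ v k ·ᵥ e k
supported-at-one-point {v = v} {k} v≗0 i with i FinP.≟ k
... | yes refl = sym (trans (cong (v i *_) (e-diag i)) (ℚP.*-identityʳ (v i)))
... | no i≢k   = trans (v≗0 i i≢k) (sym (trans (cong (v k *_) (e-off i≢k)) (ℚP.*-zeroʳ (v k))))

record IsLinear (Φ : Vector ℚ N → Vector ℚ N) : Set where
  field
    cong-≗ : ∀ {u v} → u ≗ v → Φ u ≗ Φ v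
    linear : ∀ α β u v → Φ (α ·ᵥ u +ᵥ β ·ᵥ v) ≗ α ·ᵥ Φ u +ᵥ β ·ᵥ Φ v

  homogeneous : ∀ c u → Φ (c ·ᵥ u) ≗ c ·ᵥ Φ u
  homogeneous c u i = begin
    Φ (c ·ᵥ u) i             ≡⟨ cong-≗ (λ j → sym (+0* (c * u j) (u j))) i ⟩
    Φ (c ·ᵥ u +ᵥ 0ℚ ·ᵥ u) i  ≡⟨ linear c 0ℚ u u i ⟩
    c * Φ u i + 0ℚ * Φ u i   ≡⟨ +0* (c * Φ u i) (Φ u i) ⟩
    c * Φ u i                ∎
    where
    open ≡-Reasoning
    +0* : ∀ a b → a + 0ℚ * b ≡ a
    +0* = solve 2 (λ a b → a :+ con 0ℚ :* b := a) refl

  zero-≗ : Φ 0ᵥ ≗ 0ᵥ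
  zero-≗ i = trans (homogeneous 0ℚ 0ᵥ i) (ℚP.*-zeroˡ (Φ 0ᵥ i))

∘-isLinear : ∀ {Φ Ψ : Vector ℚ N → Vector ℚ N} → IsLinear Φ → IsLinear Ψ → IsLinear (Φ ∘ Ψ)
∘-isLinear {Φ = Φ} {Ψ} Φ-lin Ψ-lin = record
  { cong-≗ = λ u≗v → Φ.cong-≗ (Ψ.cong-≗ u≗v)
  ; linear = λ α β u v i → trans (Φ.cong-≗ (Ψ.linear α β u v) i) (Φ.linear α β (Ψ u) (Ψ v) i)
  }
  where
  module Φ = IsLinear Φ-lin
  module Ψ = IsLinear Ψ-lin

reindex-isLinear : ∀ (ρ : Permutation′ N) → IsLinear (λ y m → y (ρ ⟨$⟩ʳ m))
reindex-isLinear ρ = record { cong-≗ = λ u≗v m → u≗v (ρ ⟨$⟩ʳ m) ; linear = λ _ _ _ _ _ → refl }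

PreservesPositivity PreservesNonNegativity : (Vector ℚ N → Vector ℚ N) → Set
PreservesPositivity Φ = ∀ y → AllPositive y → AllPositive (Φ y)
PreservesNonNegativity Φ = ∀ y → AllNonNegative y → AllNonNegative (Φ y)

-- If (Φ y)ₖ = a < 0, then y′ = b y − a 1 with b = (Φ 1)ₖ > 0 is positive, yet (Φ y′)ₖ = b a − a b = 0.
positivity⇒nonNegativity : ∀ {Φ : Vector ℚ N → Vector ℚ N} →
  IsLinear Φ → PreservesPositivity Φ → PreservesNonNegativity Φ
positivity⇒nonNegativity {Φ = Φ} Φ-lin Φ-pos y 0≤y k with 0ℚ ℚP.≤? Φ y k
... | yes 0≤Φyk = 0≤Φyk
... | no 0≰Φyk = ⊥-elim (ℚP.<-irrefl (sym Φy′k≡0) (Φ-pos y′ 0<y′ k))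
  where
  open IsLinear Φ-lin
  a b : ℚ
  a = Φ y k
  b = Φ 1ᵥ k
  y′ = b ·ᵥ y +ᵥ (- a) ·ᵥ 1ᵥ
  0<y′ : AllPositive y′
  0<y′ j = ℚP.+-mono-≤-<
    (0≤* (ℚP.<⇒≤ (Φ-pos 1ᵥ (λ _ → ℚP.positive⁻¹ 1ℚ) k)) (0≤y j))
    (subst (0ℚ <_) (sym (ℚP.*-identityʳ (- a))) (ℚP.neg-antimono-< (ℚP.≰⇒> 0≰Φyk)))
  Φy′k≡0 : Φ y′ k ≡ 0ℚ
  Φy′k≡0 = trans (linear b (- a) y 1ᵥ k) (solve 2 (λ a b → b :* a :+ (:- a) :* b := con 0ℚ) refl a b)

nonNegativity⇒monotone : ∀ {Φ : Vector ℚ N → Vector ℚ N} → IsLinear Φ → PreservesNonNegativity Φ →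
  ∀ {u v} → (∀ i → u i ≤ℚ v i) → ∀ i → Φ u i ≤ℚ Φ v i
nonNegativity⇒monotone {Φ = Φ} Φ-lin Φ-nonNeg {u} {v} u≤v i =
  0≤q-p⇒p≤q (subst (0ℚ ≤ℚ_) Φ-difference (Φ-nonNeg (1ℚ ·ᵥ v +ᵥ (- 1ℚ) ·ᵥ u) 0≤v-u i))
  where
  open IsLinear Φ-lin
  1·-1· : ∀ a b → 1ℚ * a + (- 1ℚ) * b ≡ a - b
  1·-1· = solve 2 (λ a b → con 1ℚ :* a :+ (:- con 1ℚ) :* b := a :- b) refl
  0≤v-u : AllNonNegative (1ℚ ·ᵥ v +ᵥ (- 1ℚ) ·ᵥ u)
  0≤v-u j = subst (0ℚ ≤ℚ_) (sym (1·-1· (v j) (u j))) (p≤q⇒0≤q-p (u≤v j))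
  Φ-difference : Φ (1ℚ ·ᵥ v +ᵥ (- 1ℚ) ·ᵥ u) i ≡ Φ v i - Φ u i
  Φ-difference = trans (linear 1ℚ (- 1ℚ) v u i) (1·-1· (Φ v i) (Φ u i))

record OrthantAutomorphism (Φ Ψ : Vector ℚ N → Vector ℚ N) : Set where
  field
    Φ-linear   : IsLinear Φ
    Ψ-linear   : IsLinear Ψ
    Φ-positive : PreservesPositivity Φ
    Ψ-positive : PreservesPositivity Ψ
    Ψ∘Φ≗id     : ∀ y → Ψ (Φ y) ≗ y
    Φ∘Ψ≗id     : ∀ y → Φ (Ψ y) ≗ y

  Φ-nonNegative : PreservesNonNegativity Φ
  Φ-nonNegative = positivity⇒nonNegativity Φ-linear Φ-positive

  Ψ-nonNegative : PreservesNonNegativity Ψ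
  Ψ-nonNegative = positivity⇒nonNegativity Ψ-linear Ψ-positive

OrthantAutomorphism-inverse : ∀ {Φ Ψ : Vector ℚ N → Vector ℚ N} →
  OrthantAutomorphism Φ Ψ → OrthantAutomorphism Ψ Φ
OrthantAutomorphism-inverse A = record
  { Φ-linear = Ψ-linear ; Ψ-linear = Φ-linear
  ; Φ-positive = Ψ-positive ; Ψ-positive = Φ-positive
  ; Ψ∘Φ≗id = Φ∘Ψ≗id ; Φ∘Ψ≗id = Ψ∘Φ≗id
  }
  where open OrthantAutomorphism A

unit-image≢0 : ∀ {Φ Ψ : Vector ℚ N → Vector ℚ N} → IsLinear Ψ → (∀ y → Ψ (Φ y) ≗ y) →
  ∀ j → ∃[ k ] Φ (e j) k ≢ 0ℚ
unit-image≢0 {N = N} {Φ} {Ψ} Ψ-lin Ψ∘Φ≗id j =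
  FinP.¬∀⟶∃¬ N (λ k → Φ (e j) k ≡ 0ℚ) (λ k → Φ (e j) k ℚP.≟ 0ℚ) Φej≢0
  where
  open IsLinear Ψ-lin
  open ≡-Reasoning
  Φej≢0 : ¬ (∀ k → Φ (e j) k ≡ 0ℚ)
  Φej≢0 Φej≗0 = ℚP.1≢0 (begin
    1ℚ              ≡⟨ sym (e-diag j) ⟩
    e j j           ≡⟨ sym (Ψ∘Φ≗id (e j) j) ⟩
    Ψ (Φ (e j)) j   ≡⟨ cong-≗ Φej≗0 j ⟩
    Ψ 0ᵥ j          ≡⟨ zero-≗ j ⟩
    0ℚ              ∎)

-- With c = (Φ (e j))ₖ > 0 we have c e k ≤ Φ (e j), hence 0 ≤ c Ψ (e k) ≤ Ψ (Φ (e j)) = e j.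
unit-image-exclusive : ∀ {Φ Ψ : Vector ℚ N → Vector ℚ N} → OrthantAutomorphism Φ Ψ →
  ∀ {j k} → Φ (e j) k ≢ 0ℚ → ∀ i → i ≢ j → Ψ (e k) i ≡ 0ℚ
unit-image-exclusive {Φ = Φ} {Ψ} A {j} {k} Φejk≢0 i i≢j =
  ℚP.≤-antisym Ψeki≤0 (Ψ-nonNegative (e k) (e-nonNegative k) i)
  where
  open OrthantAutomorphism A
  open IsLinear Ψ-linear
  c : ℚ
  c = Φ (e j) k
  0<c : 0ℚ < c
  0<c = 0≤∧≢0⇒0< (Φ-nonNegative (e j) (e-nonNegative j) k) Φejk≢0
  c·ek≤Φej : ∀ l → (c ·ᵥ e k) l ≤ℚ Φ (e j) l
  c·ek≤Φej l with l FinP.≟ k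
  ... | yes refl = ℚP.≤-reflexive (trans (cong (c *_) (e-diag k)) (ℚP.*-identityʳ c))
  ... | no l≢k   = subst (_≤ℚ Φ (e j) l) (sym (trans (cong (c *_) (e-off l≢k)) (ℚP.*-zeroʳ c)))
                     (Φ-nonNegative (e j) (e-nonNegative j) l)
  c·Ψeki≤0 : c * Ψ (e k) i ≤ℚ c * 0ℚ
  c·Ψeki≤0 = begin
    c * Ψ (e k) i      ≡⟨ homogeneous c (e k) i ⟨
    Ψ (c ·ᵥ e k) i     ≤⟨ nonNegativity⇒monotone Ψ-linear Ψ-nonNegative c·ek≤Φej i ⟩
    Ψ (Φ (e j)) i      ≡⟨ Ψ∘Φ≗id (e j) i ⟩
    e j i              ≡⟨ e-off i≢j ⟩
    0ℚ                 ≡⟨ ℚP.*-zeroʳ c ⟨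
    c * 0ℚ             ∎
    where open ℚP.≤-Reasoning
  Ψeki≤0 : Ψ (e k) i ≤ℚ 0ℚ
  Ψeki≤0 = ℚP.*-cancelˡ-≤-pos c {{ℚ.positive 0<c}} c·Ψeki≤0

orthantAutomorphism⇒monomial : ∀ {Φ Ψ : Vector ℚ N → Vector ℚ N} → OrthantAutomorphism Φ Ψ →
  ∃[ σ ] ∀ j → ∃[ c ] 0ℚ < c × Φ (e j) ≗ c ·ᵥ e (σ ⟨$⟩ʳ j)
orthantAutomorphism⇒monomial {N = N} {Φ} {Ψ} A = σ , λ j → c j , 0<c j , Φej≗c·eσj j
  where
  open OrthantAutomorphism A
  open ≡-Reasoning
  A⁻¹ : OrthantAutomorphism Ψ Φ
  A⁻¹ = OrthantAutomorphism-inverse A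
  f g : Fin N → Fin N
  f j = proj₁ (unit-image≢0 Ψ-linear Ψ∘Φ≗id j)
  g k = proj₁ (unit-image≢0 Φ-linear Φ∘Ψ≗id k)
  Φej≢0 : ∀ j → Φ (e j) (f j) ≢ 0ℚ
  Φej≢0 j = proj₂ (unit-image≢0 Ψ-linear Ψ∘Φ≗id j)
  Ψek≢0 : ∀ k → Ψ (e k) (g k) ≢ 0ℚ
  Ψek≢0 k = proj₂ (unit-image≢0 Φ-linear Φ∘Ψ≗id k)
  g∘f : ∀ j → g (f j) ≡ j
  g∘f j = decidable-stable (g (f j) FinP.≟ j)
    (λ gfj≢j → Ψek≢0 (f j) (unit-image-exclusive A (Φej≢0 j) (g (f j)) gfj≢j))
  f∘g : ∀ k → f (g k) ≡ k
  f∘g k = decidable-stable (f (g k) FinP.≟ k)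
    (λ fgk≢k → Φej≢0 (g k) (unit-image-exclusive A⁻¹ (Ψek≢0 k) (f (g k)) fgk≢k))
  σ : Permutation′ N
  σ = Perm.permutation f g f∘g g∘f
  c : Fin N → ℚ
  c j = Φ (e j) (f j)
  0<c : ∀ j → 0ℚ < c j
  0<c j = 0≤∧≢0⇒0< (Φ-nonNegative (e j) (e-nonNegative j) (f j)) (Φej≢0 j)
  Φej≗c·eσj : ∀ j → Φ (e j) ≗ c j ·ᵥ e (f j)
  Φej≗c·eσj j = supported-at-one-point λ i i≢fj → begin
    Φ (e j) i           ≡⟨ cong (λ l → Φ (e l) i) (g∘f j) ⟨
    Φ (e (g (f j))) i   ≡⟨ unit-image-exclusive A⁻¹ (Ψek≢0 (f j)) i i≢fj ⟩
    0ℚ                  ∎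

-- Walks through the levels

Z-cong : ∀ {x x′ : Vector ℚ N} → x ≗ x′ → Z x ≗ Z x′
Z-cong         x≗x′ zero    = refl
Z-cong {suc N} x≗x′ (suc i) = cong₂ _+_ (x≗x′ zero) (Z-cong (x≗x′ ∘ suc) i)

Z-linear : ∀ α β (u v : Vector ℚ N) i → Z (α ·ᵥ u +ᵥ β ·ᵥ v) i ≡ α * Z u i + β * Z v i
Z-linear         α β u v zero    = solve 2 (λ α β → con 0ℚ := α :* con 0ℚ :+ β :* con 0ℚ) refl α β
Z-linear {suc N} α β u v (suc i) = begin
  (α * u zero + β * v zero) + Z (α ·ᵥ u ∘ suc +ᵥ β ·ᵥ v ∘ suc) i
    ≡⟨ cong (α * u zero + β * v zero +_) (Z-linear α β (u ∘ suc) (v ∘ suc) i) ⟩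
  (α * u zero + β * v zero) + (α * Z (u ∘ suc) i + β * Z (v ∘ suc) i)
    ≡⟨ solve 6 (λ α β a b c d → (α :* a :+ β :* b) :+ (α :* c :+ β :* d) := α :* (a :+ c) :+ β :* (b :+ d))
             refl α β (u zero) (v zero) (Z (u ∘ suc) i) (Z (v ∘ suc) i) ⟩
  α * (u zero + Z (u ∘ suc) i) + β * (v zero + Z (v ∘ suc) i)
    ∎
  where open ≡-Reasoning

Z-zero : ∀ (i : Fin (suc N)) → Z {N} 0ᵥ i ≡ 0ℚ
Z-zero         zero    = refl
Z-zero {suc N} (suc i) = cong (0ℚ +_) (Z-zero i)

Z-suc : ∀ (x : Vector ℚ N) m → Z x (suc m) ≡ Z x (inject₁ m) + x m
Z-suc         x zero    = ℚP.+-comm (x zero) 0ℚ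
Z-suc {suc N} x (suc m) = trans (cong (x zero +_) (Z-suc (x ∘ suc) m))
  (sym (ℚP.+-assoc (x zero) (Z (x ∘ suc) (inject₁ m)) (x (suc m))))

Z-nonNegative : ∀ {y : Vector ℚ N} → AllPositive y → ∀ i → 0ℚ ≤ℚ Z y i
Z-nonNegative         0<y zero    = ℚP.≤-refl
Z-nonNegative {suc N} 0<y (suc i) = ℚP.+-mono-≤ (ℚP.<⇒≤ (0<y zero)) (Z-nonNegative (0<y ∘ suc) i)

Z-strictlyIncreasing : ∀ {y : Vector ℚ N} → AllPositive y → ∀ {a b} → a Fin.< b → Z y a < Z y b
Z-strictlyIncreasing {suc N}     0<y {zero}  {suc b} _   = ℚP.+-mono-<-≤ (0<y zero) (Z-nonNegative (0<y ∘ suc) b)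
Z-strictlyIncreasing {suc N} {y} 0<y {suc a} {suc b} a<b =
  ℚP.+-monoʳ-< (y zero) (Z-strictlyIncreasing (0<y ∘ suc) (ℕ.s≤s⁻¹ a<b))

strictlyIncreasing⇒<⇔ : ∀ {n} {g : Fin n → ℚ} → (∀ {a b} → a Fin.< b → g a < g b) →
  ∀ a b → (g a < g b) ⇔ (a Fin.< b)
strictlyIncreasing⇒<⇔ {g = g} g-incr a b = mk⇔ reflect g-incr
  where
  reflect : g a < g b → a Fin.< b
  reflect ga<gb with FinP.<-cmp a b
  ... | tri< a<b _ _ = a<b
  ... | tri≈ _ refl _ = ⊥-elim (ℚP.<-irrefl refl ga<gb)
  ... | tri> _ _ b<a = ⊥-elim (ℚP.<-asym ga<gb (g-incr b<a))

has-pattern-cong : ∀ (π : Permutation′ (suc N)) {x x′} → x ≗ x′ → x has-pattern π → x′ has-pattern π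
has-pattern-cong π x≗x′ x∈π i k rewrite sym (Z-cong x≗x′ i) | sym (Z-cong x≗x′ k) = x∈π i k

Δ : (Fin (suc N) → ℚ) → Vector ℚ N
Δ f m = f (suc m) - f (inject₁ m)

Z-Δ : ∀ (f : Fin (suc N) → ℚ) i → Z (Δ f) i ≡ f i - f zero
Z-Δ         f zero    = sym (ℚP.+-inverseʳ (f zero))
Z-Δ {suc N} f (suc i) = trans (cong (Δ f zero +_) (Z-Δ (f ∘ suc) i))
  (solve 3 (λ a b c → (b :- a) :+ (c :- b) := c :- a) refl (f zero) (f (suc zero)) (f (suc i)))

-- If y lists the gaps between consecutive levels 0 < 1 < … < N (so level v sits at height Z y v),
-- steps π y is the step sequence of the walk visiting the levels in the order π(0), π(1), …, π(N).
steps : Permutation′ (suc N) → Vector ℚ N → Vector ℚ N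
steps π y = Δ (λ i → Z y (π ⟨$⟩ʳ i))

Z-steps : ∀ (π : Permutation′ (suc N)) y i → Z (steps π y) i ≡ Z y (π ⟨$⟩ʳ i) - Z y (π ⟨$⟩ʳ zero)
Z-steps π y = Z-Δ (λ i → Z y (π ⟨$⟩ʳ i))

steps-inverse : ∀ {π σ : Permutation′ (suc N)} → (∀ v → π ⟨$⟩ʳ (σ ⟨$⟩ʳ v) ≡ v) →
  ∀ y → steps σ (steps π y) ≗ y
steps-inverse {π = π} {σ} π∘σ≗id y k = begin
  Z (steps π y) (σ ⟨$⟩ʳ suc k) - Z (steps π y) (σ ⟨$⟩ʳ inject₁ k)
    ≡⟨ cong₂ _-_ (Z-steps π y (σ ⟨$⟩ʳ suc k)) (Z-steps π y (σ ⟨$⟩ʳ inject₁ k)) ⟩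
  (Z y (π ⟨$⟩ʳ (σ ⟨$⟩ʳ suc k)) - c) - (Z y (π ⟨$⟩ʳ (σ ⟨$⟩ʳ inject₁ k)) - c)
    ≡⟨ cong₂ (λ a b → (Z y a - c) - (Z y b - c)) (π∘σ≗id (suc k)) (π∘σ≗id (inject₁ k)) ⟩
  (Z y (suc k) - c) - (Z y (inject₁ k) - c)
    ≡⟨ cong (λ a → (a - c) - (Z y (inject₁ k) - c)) (Z-suc y k) ⟩
  ((Z y (inject₁ k) + y k) - c) - (Z y (inject₁ k) - c)
    ≡⟨ solve 3 (λ a b c → ((a :+ b) :- c) :- (a :- c) := b) refl (Z y (inject₁ k)) (y k) c ⟩
  y k ∎
  where
  open ≡-Reasoning
  c = Z y (π ⟨$⟩ʳ zero)

steps-isLinear : ∀ (π : Permutation′ (suc N)) → IsLinear (steps π)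
steps-isLinear π = record
  { cong-≗ = λ u≗v m → cong₂ _-_ (Z-cong u≗v (π ⟨$⟩ʳ suc m)) (Z-cong u≗v (π ⟨$⟩ʳ inject₁ m))
  ; linear = λ α β u v m → begin
      Z (α ·ᵥ u +ᵥ β ·ᵥ v) (π ⟨$⟩ʳ suc m) - Z (α ·ᵥ u +ᵥ β ·ᵥ v) (π ⟨$⟩ʳ inject₁ m)
        ≡⟨ cong₂ _-_ (Z-linear α β u v (π ⟨$⟩ʳ suc m)) (Z-linear α β u v (π ⟨$⟩ʳ inject₁ m)) ⟩
      (α * Z u (π ⟨$⟩ʳ suc m) + β * Z v (π ⟨$⟩ʳ suc m)) - (α * Z u (π ⟨$⟩ʳ inject₁ m) + β * Z v (π ⟨$⟩ʳ inject₁ m))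
        ≡⟨ solve 6 (λ α β a b c d → (α :* a :+ β :* b) :- (α :* c :+ β :* d) := α :* (a :- c) :+ β :* (b :- d))
                 refl α β _ _ _ _ ⟩
      α * steps π u m + β * steps π v m ∎
  }
  where open ≡-Reasoning

steps-has-pattern : ∀ (π : Permutation′ (suc N)) {y} → AllPositive y → steps π y has-pattern π
steps-has-pattern π {y} 0<y i k =
  subst₂ (λ a b → (a < b) ⇔ _) (sym (Z-steps π y i)) (sym (Z-steps π y k))
    (strictlyIncreasing⇒<⇔ shifted-incr (π ⟨$⟩ʳ i) (π ⟨$⟩ʳ k))
  where
  shifted-incr : ∀ {a b} → a Fin.< b → Z y a - Z y (π ⟨$⟩ʳ zero) < Z y b - Z y (π ⟨$⟩ʳ zero)
  shifted-incr a<b = ℚP.+-monoˡ-< (- Z y (π ⟨$⟩ʳ zero)) (Z-strictlyIncreasing 0<y a<b)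

has-pattern⇒positive : ∀ (π : Permutation′ (suc N)) {x} → x has-pattern π →
  AllPositive (steps (Perm.flip π) x)
has-pattern⇒positive π {x} x∈π k = p<q⇒0<q-p (Equivalence.from (x∈π (π ⟨$⟩ˡ inject₁ k) (π ⟨$⟩ˡ suc k))
  (subst₂ Fin._<_ (sym (Perm.inverseʳ π)) (sym (Perm.inverseʳ π)) (FinP.≤̄⇒inject₁< FinP.≤-refl)))

-- The step matrix and the edge data

[_<_] : Fin N → Fin (suc N) → ℚ
[ j < v ] = if does (toℕ j ℕ.<? toℕ v) then 1ℚ else 0ℚ

[<]-true : ∀ {j : Fin N} {v} → toℕ j ℕ.< toℕ v → [ j < v ] ≡ 1ℚ
[<]-true {j = j} {v} j<v = cong (if_then 1ℚ else 0ℚ) (dec-true (toℕ j ℕ.<? toℕ v) j<v)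

[<]-false : ∀ {j : Fin N} {v} → ¬ (toℕ j ℕ.< toℕ v) → [ j < v ] ≡ 0ℚ
[<]-false {j = j} {v} j≮v = cong (if_then 1ℚ else 0ℚ) (dec-false (toℕ j ℕ.<? toℕ v) j≮v)

Z-unit : ∀ (j : Fin N) v → Z (e j) v ≡ [ j < v ]
Z-unit         j       zero    = refl
Z-unit {suc N} zero    (suc v) = cong (1ℚ +_) (Z-zero v)
Z-unit {suc N} (suc j) (suc v) = trans (ℚP.+-identityˡ _) (Z-unit j v)

Z-as-sum : ∀ (y : Vector ℚ N) v → Z y v ≡ sum (λ j → [ j < v ] * y j)
Z-as-sum {N} y zero = sym (trans (sum-cong-≗ (λ j → ℚP.*-zeroˡ (y j))) (sum-replicate-zero N))
Z-as-sum {suc N} y (suc v) =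
  cong₂ _+_ (sym (ℚP.*-identityˡ (y zero))) (Z-as-sum (y ∘ suc) v)

∑-distrib-minus : ∀ (f g : Vector ℚ N) → sum f - sum g ≡ sum (λ j → f j - g j)
∑-distrib-minus {zero}  f g = refl
∑-distrib-minus {suc N} f g = trans
  (solve 4 (λ a b c d → (a :+ b) :- (c :+ d) := (a :- c) :+ (b :- d)) refl (f zero) (sum (f ∘ suc)) (g zero) (sum (g ∘ suc)))
  (cong (f zero - g zero +_) (∑-distrib-minus (f ∘ suc) (g ∘ suc)))

stepMatrix : Permutation′ (suc N) → Fin N → Fin N → ℚ
stepMatrix π m j = [ j < π ⟨$⟩ʳ suc m ] - [ j < π ⟨$⟩ʳ inject₁ m ]

steps-unit : ∀ (π : Permutation′ (suc N)) j m → steps π (e j) m ≡ stepMatrix π m j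
steps-unit π j m = cong₂ _-_ (Z-unit j (π ⟨$⟩ʳ suc m)) (Z-unit j (π ⟨$⟩ʳ inject₁ m))

steps-as-sum : ∀ (π : Permutation′ (suc N)) y m → steps π y m ≡ sum (λ j → stepMatrix π m j * y j)
steps-as-sum {N} π y m = begin
  Z y b - Z y a
    ≡⟨ cong₂ _-_ (Z-as-sum y b) (Z-as-sum y a) ⟩
  sum (λ j → [ j < b ] * y j) - sum (λ j → [ j < a ] * y j)
    ≡⟨ ∑-distrib-minus (λ j → [ j < b ] * y j) (λ j → [ j < a ] * y j) ⟩
  sum (λ j → [ j < b ] * y j - [ j < a ] * y j)
    ≡⟨ sum-cong-≗ (λ j → solve 3 (λ s t y → s :* y :- t :* y := (s :- t) :* y) refl [ j < b ] [ j < a ] (y j)) ⟩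
  sum (λ j → stepMatrix π m j * y j) ∎
  where
  open ≡-Reasoning
  a b : Fin (suc N)
  a = π ⟨$⟩ʳ inject₁ m
  b = π ⟨$⟩ʳ suc m

⟨$⟩ʳ-injective : ∀ {n} (σ : Permutation′ n) {i j} → σ ⟨$⟩ʳ i ≡ σ ⟨$⟩ʳ j → i ≡ j
⟨$⟩ʳ-injective σ = Injection.injective (↔⇒↣ σ)

signℚ : Sign → ℚ
signℚ Sign.+ = 1ℚ
signℚ Sign.- = - 1ℚ

signℚ≢0 : ∀ s → signℚ s ≢ 0ℚ
signℚ≢0 Sign.+ ()
signℚ≢0 Sign.- ()

signℚ-injective : ∀ {s s′} → signℚ s ≡ signℚ s′ → s ≡ s′
signℚ-injective {Sign.+} {Sign.+} _ = refl
signℚ-injective {Sign.-} {Sign.-} _ = refl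
signℚ-injective {Sign.+} {Sign.-} ()
signℚ-injective {Sign.-} {Sign.+} ()

signℚ≡c*signℚ⇒c≡1 : ∀ {c} s s′ → 0ℚ < c → signℚ s ≡ c * signℚ s′ → c ≡ 1ℚ
signℚ≡c*signℚ⇒c≡1 {c} Sign.+ Sign.+ _   eq = trans (sym (ℚP.*-identityʳ c)) (sym eq)
signℚ≡c*signℚ⇒c≡1 {c} Sign.- Sign.- _   eq = ℚP.neg-injective (trans (sym (c*-1≡-c c)) (sym eq))
  where c*-1≡-c = solve 1 (λ c → c :* (:- con 1ℚ) := :- c) refl
signℚ≡c*signℚ⇒c≡1 {c} Sign.+ Sign.- 0<c eq = ⊥-elim (¬0<-1 (subst (0ℚ <_) c≡-1 0<c))
  where
  c≡-1 : c ≡ - 1ℚ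
  c≡-1 = ℚP.neg-injective (trans (solve 1 (λ c → :- c := c :* (:- con 1ℚ)) refl c) (sym eq))
signℚ≡c*signℚ⇒c≡1 {c} Sign.- Sign.+ 0<c eq =
  ⊥-elim (¬0<-1 (subst (0ℚ <_) (trans (sym (ℚP.*-identityʳ c)) (sym eq)) 0<c))

module _ (π : Permutation′ (suc N)) (m : Fin N) where
  private
    a b : ℕ
    a = toℕ (π ⟨$⟩ʳ inject₁ m)
    b = toℕ (π ⟨$⟩ʳ suc m)

  ε-ascent : a ℕ.< b → ε π m ≡ Sign.+
  ε-ascent a<b rewrite dec-true ((π ⟨$⟩ʳ inject₁ m) Fin.<? (π ⟨$⟩ʳ suc m)) a<b = refl

  ε-descent : ¬ (a ℕ.< b) → ε π m ≡ Sign.-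
  ε-descent a≮b rewrite dec-false ((π ⟨$⟩ʳ inject₁ m) Fin.<? (π ⟨$⟩ʳ suc m)) a≮b = refl

  S? : ∀ j → Dec (S π m j)
  S? j = (a ℕ.⊓ b ℕ.≤? toℕ j) ×-dec (toℕ j ℕ.<? a ℕ.⊔ b)

  stepMatrix-inside : ∀ {j} → S π m j → stepMatrix π m j ≡ signℚ (ε π m)
  stepMatrix-inside {j} (a⊓b≤j , j<a⊔b) with toℕ j ℕ.<? a | toℕ j ℕ.<? b
  ... | yes j<a | yes j<b = ⊥-elim (ℕP.<⇒≱ (ℕP.⊓-glb j<a j<b) a⊓b≤j)
  ... | no j≮a  | no j≮b  = ⊥-elim (ℕP.<⇒≱ j<a⊔b (ℕP.⊔-lub (ℕP.≮⇒≥ j≮a) (ℕP.≮⇒≥ j≮b)))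
  ... | yes j<a | no j≮b
    rewrite [<]-true {j = j} j<a | [<]-false {j = j} j≮b | ε-descent (λ a<b → j≮b (ℕP.<-trans j<a a<b)) = refl
  ... | no j≮a  | yes j<b
    rewrite [<]-false {j = j} j≮a | [<]-true {j = j} j<b | ε-ascent (ℕP.≤-<-trans (ℕP.≮⇒≥ j≮a) j<b) = refl

  stepMatrix-outside : ∀ {j} → ¬ S π m j → stepMatrix π m j ≡ 0ℚ
  stepMatrix-outside {j} j∉S with toℕ j ℕ.<? a | toℕ j ℕ.<? b
  ... | yes j<a | yes j<b rewrite [<]-true {j = j} j<a | [<]-true {j = j} j<b = refl
  ... | no j≮a  | no j≮b  rewrite [<]-false {j = j} j≮a | [<]-false {j = j} j≮b = refl
  ... | yes j<a | no j≮b  = ⊥-elim (j∉S (ℕP.≤-trans (ℕP.m⊓n≤n a b) (ℕP.≮⇒≥ j≮b) , ℕP.<-≤-trans j<a (ℕP.m≤m⊔n a b)))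
  ... | no j≮a  | yes j<b = ⊥-elim (j∉S (ℕP.≤-trans (ℕP.m⊓n≤m a b) (ℕP.≮⇒≥ j≮a) , ℕP.<-≤-trans j<b (ℕP.m≤n⊔m a b)))

  S⇔stepMatrix≢0 : ∀ j → S π m j ⇔ (stepMatrix π m j ≢ 0ℚ)
  S⇔stepMatrix≢0 j = mk⇔
    (λ j∈S eq → signℚ≢0 (ε π m) (trans (sym (stepMatrix-inside j∈S)) eq))
    (λ ≢0 → decidable-stable (S? j) (λ j∉S → ≢0 (stepMatrix-outside j∉S)))

  S-nonempty : ∃[ j ] S π m j
  S-nonempty = fromℕ< a⊓b<N , subst (λ t → a ℕ.⊓ b ≤ t × t ℕ.< a ℕ.⊔ b) (sym (FinP.toℕ-fromℕ< a⊓b<N))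
                                 (ℕP.≤-refl , a⊓b<a⊔b)
    where
    a≢b : a ≢ b
    a≢b = FinP.<⇒≢ (FinP.≤̄⇒inject₁< FinP.≤-refl) ∘ ⟨$⟩ʳ-injective π ∘ FinP.toℕ-injective
    a⊓b<a⊔b : a ℕ.⊓ b ℕ.< a ℕ.⊔ b
    a⊓b<a⊔b with ℕP.<-cmp a b
    ... | tri< a<b _ _ = ℕP.<-≤-trans (ℕP.≤-<-trans (ℕP.m⊓n≤m a b) a<b) (ℕP.m≤n⊔m a b)
    ... | tri≈ _ a≡b _ = ⊥-elim (a≢b a≡b)
    ... | tri> _ _ b<a = ℕP.<-≤-trans (ℕP.≤-<-trans (ℕP.m⊓n≤n a b) b<a) (ℕP.m≤m⊔n a b)
    a⊓b<N : a ℕ.⊓ b ℕ.< N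
    a⊓b<N = ℕP.<-≤-trans a⊓b<a⊔b (ℕ.s≤s⁻¹ (ℕP.⊔-lub (FinP.toℕ<n (π ⟨$⟩ʳ inject₁ m)) (FinP.toℕ<n (π ⟨$⟩ʳ suc m))))

steps-flip-steps : ∀ (π : Permutation′ (suc N)) y → steps (Perm.flip π) (steps π y) ≗ y
steps-flip-steps π = steps-inverse {π = π} {σ = Perm.flip π} (λ _ → Perm.inverseʳ π)

steps-steps-flip : ∀ (π : Permutation′ (suc N)) x → steps π (steps (Perm.flip π) x) ≗ x
steps-steps-flip π = steps-inverse {π = Perm.flip π} {σ = π} (λ _ → Perm.inverseˡ π)

stepMatrix-column≢0 : ∀ (π : Permutation′ (suc N)) j → ∃[ m ] stepMatrix π m j ≢ 0ℚ
stepMatrix-column≢0 π j =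
  let m , steps-ej≢0 = unit-image≢0 (steps-isLinear (Perm.flip π)) (steps-flip-steps π) j
  in m , steps-ej≢0 ∘ trans (steps-unit π j m)

stepMatrix-rows-distinct : ∀ (π : Permutation′ (suc N)) {m m′} →
  (∀ j → stepMatrix π m j ≡ stepMatrix π m′ j) → m ≡ m′
stepMatrix-rows-distinct π {m} {m′} rows = decidable-stable (m FinP.≟ m′) λ m≢m′ → ℚP.1≢0 (begin
  1ℚ                                    ≡⟨ e-diag m ⟨
  e m m                                 ≡⟨ steps-steps-flip π (e m) m ⟨
  steps π y m                           ≡⟨ steps-as-sum π y m ⟩
  sum (λ j → stepMatrix π m j * y j)    ≡⟨ sum-cong-≗ (λ j → cong (_* y j) (rows j)) ⟩
  sum (λ j → stepMatrix π m′ j * y j)   ≡⟨ steps-as-sum π y m′ ⟨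
  steps π y m′                          ≡⟨ steps-steps-flip π (e m) m′ ⟩
  e m m′                                ≡⟨ e-off (m≢m′ ∘ sym) ⟩
  0ℚ                                    ∎)
  where
  open ≡-Reasoning
  y = steps (Perm.flip π) (e m)

image-≐⇔ : ∀ (σ : Permutation′ N) {A B : Levels N} → (∀ i → A i ⇔ B (σ ⟨$⟩ʳ i)) ⇔ (image σ A ≐ B)
image-≐⇔ σ {A} {B} = mk⇔ to from
  where
  to : (∀ i → A i ⇔ B (σ ⟨$⟩ʳ i)) → image σ A ≐ B
  to A⇔B j = mk⇔
    (λ { (i , i∈A , σi≡j) → subst B σi≡j (Equivalence.to (A⇔B i) i∈A) })
    (λ j∈B → σ ⟨$⟩ˡ j , Equivalence.from (A⇔B (σ ⟨$⟩ˡ j)) (subst B (sym (Perm.inverseʳ σ)) j∈B) , Perm.inverseʳ σ)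
  from : image σ A ≐ B → ∀ i → A i ⇔ B (σ ⟨$⟩ʳ i)
  from σA≐B i = mk⇔
    (λ i∈A → Equivalence.to (σA≐B (σ ⟨$⟩ʳ i)) (i , i∈A , refl))
    (λ σi∈B → let (i′ , i′∈A , σi′≡σi) = Equivalence.from (σA≐B (σ ⟨$⟩ʳ i)) σi∈B
              in subst A (⟨$⟩ʳ-injective σ σi′≡σi) i′∈A)

rows⇔edges : ∀ (σ : Permutation′ N) (π τ : Permutation′ (suc N)) m m′ →
  (∀ j → stepMatrix π m j ≡ stepMatrix τ m′ (σ ⟨$⟩ʳ j)) ⇔ ((image σ (S π m) ≐ S τ m′) × (ε π m ≡ ε τ m′))
rows⇔edges σ π τ m m′ = mk⇔ to from
  where
  to : (∀ j → stepMatrix π m j ≡ stepMatrix τ m′ (σ ⟨$⟩ʳ j)) → (image σ (S π m) ≐ S τ m′) × (ε π m ≡ ε τ m′)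
  to rows = Equivalence.to (image-≐⇔ σ) S⇔S′ , ε≡ε′
    where
    S⇔S′ : ∀ j → S π m j ⇔ S τ m′ (σ ⟨$⟩ʳ j)
    S⇔S′ j = ⇔.trans (subst (λ r → S π m j ⇔ (r ≢ 0ℚ)) (rows j) (S⇔stepMatrix≢0 π m j))
                     (⇔.sym (S⇔stepMatrix≢0 τ m′ (σ ⟨$⟩ʳ j)))
    ε≡ε′ : ε π m ≡ ε τ m′
    ε≡ε′ = let j , j∈S = S-nonempty π m in signℚ-injective (begin
      signℚ (ε π m)               ≡⟨ stepMatrix-inside π m j∈S ⟨
      stepMatrix π m j            ≡⟨ rows j ⟩
      stepMatrix τ m′ (σ ⟨$⟩ʳ j)  ≡⟨ stepMatrix-inside τ m′ (Equivalence.to (S⇔S′ j) j∈S) ⟩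
      signℚ (ε τ m′)              ∎)
      where open ≡-Reasoning
  from : (image σ (S π m) ≐ S τ m′) × (ε π m ≡ ε τ m′) → ∀ j → stepMatrix π m j ≡ stepMatrix τ m′ (σ ⟨$⟩ʳ j)
  from (σS≐S′ , ε≡ε′) j with S? π m j
  ... | yes j∈S = trans (stepMatrix-inside π m j∈S)
                    (trans (cong signℚ ε≡ε′) (sym (stepMatrix-inside τ m′ (Equivalence.to S⇔S′ j∈S))))
    where S⇔S′ = Equivalence.from (image-≐⇔ σ) σS≐S′ j
  ... | no j∉S = trans (stepMatrix-outside π m j∉S)
                   (sym (stepMatrix-outside τ m′ (j∉S ∘ Equivalence.from S⇔S′)))
    where S⇔S′ = Equivalence.from (image-≐⇔ σ) σS≐S′ j

-- Matching rows of step matrices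

RowsMatch : Permutation′ N → Permutation′ N → Permutation′ (suc N) → Permutation′ (suc N) → Set
RowsMatch σ ρ π τ = ∀ m j → stepMatrix π (ρ ⟨$⟩ʳ m) j ≡ stepMatrix τ m (σ ⟨$⟩ʳ j)

module _ (σ ρ : Permutation′ N) (π τ : Permutation′ (suc N)) (match : RowsMatch σ ρ π τ) where

  RowsMatch-flip : RowsMatch (Perm.flip σ) (Perm.flip ρ) τ π
  RowsMatch-flip m j = begin
    stepMatrix τ (ρ ⟨$⟩ˡ m) j                        ≡⟨ cong (stepMatrix τ (ρ ⟨$⟩ˡ m)) (Perm.inverseʳ σ) ⟨
    stepMatrix τ (ρ ⟨$⟩ˡ m) (σ ⟨$⟩ʳ (σ ⟨$⟩ˡ j))      ≡⟨ match (ρ ⟨$⟩ˡ m) (σ ⟨$⟩ˡ j) ⟨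
    stepMatrix π (ρ ⟨$⟩ʳ (ρ ⟨$⟩ˡ m)) (σ ⟨$⟩ˡ j)      ≡⟨ cong (λ m → stepMatrix π m (σ ⟨$⟩ˡ j)) (Perm.inverseʳ ρ) ⟩
    stepMatrix π m (σ ⟨$⟩ˡ j)                        ∎
    where open ≡-Reasoning

  steps-intertwine : ∀ y m → steps π y (ρ ⟨$⟩ʳ m) ≡ steps τ (λ k → y (σ ⟨$⟩ˡ k)) m
  steps-intertwine y m = begin
    steps π y (ρ ⟨$⟩ʳ m)                                     ≡⟨ steps-as-sum π y (ρ ⟨$⟩ʳ m) ⟩
    sum (λ j → stepMatrix π (ρ ⟨$⟩ʳ m) j * y j)              ≡⟨ sum-cong-≗ (λ j → cong₂ _*_ (match m j) (cong y (sym (Perm.inverseˡ σ)))) ⟩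
    sum (λ j → stepMatrix τ m (σ ⟨$⟩ʳ j) * y′ (σ ⟨$⟩ʳ j))    ≡⟨ sum-permute (λ k → stepMatrix τ m k * y′ k) σ ⟨
    sum (λ k → stepMatrix τ m k * y′ k)                      ≡⟨ steps-as-sum τ y′ m ⟨
    steps τ y′ m                                             ∎
    where
    open ≡-Reasoning
    y′ = λ k → y (σ ⟨$⟩ˡ k)

  RowsMatch-has-pattern : ∀ {x} → x has-pattern π → (λ m → x (ρ ⟨$⟩ʳ m)) has-pattern τ
  RowsMatch-has-pattern {x} x∈π = has-pattern-cong τ steps-y′≗x∘ρ (steps-has-pattern τ (0<y ∘ (σ ⟨$⟩ˡ_)))
    where
    y = steps (Perm.flip π) x
    0<y = has-pattern⇒positive π x∈π
    steps-y′≗x∘ρ : steps τ (λ k → y (σ ⟨$⟩ˡ k)) ≗ (λ m → x (ρ ⟨$⟩ʳ m))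
    steps-y′≗x∘ρ m = trans (sym (steps-intertwine y m)) (steps-steps-flip π x (ρ ⟨$⟩ʳ m))

RowsMatch⇒∼ : ∀ (σ ρ : Permutation′ N) π τ → RowsMatch σ ρ π τ → π ∼ τ
RowsMatch⇒∼ σ ρ π τ match = ρ , λ x → mk⇔ (RowsMatch-has-pattern σ ρ π τ match)
  (has-pattern-cong π (λ m → cong x (Perm.inverseʳ ρ))
    ∘ RowsMatch-has-pattern (Perm.flip σ) (Perm.flip ρ) τ π (RowsMatch-flip σ ρ π τ match))

RowsMatch⇒EdgeSetsMatch : ∀ (σ ρ : Permutation′ N) π τ → RowsMatch σ ρ π τ → EdgeSetsMatch σ π τ
RowsMatch⇒EdgeSetsMatch σ ρ π τ match =
  (λ m → ρ ⟨$⟩ˡ m , rows⇒edges (λ j → trans (cong (λ m → stepMatrix π m j) (sym (Perm.inverseʳ ρ))) (match _ j))) ,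
  (λ m′ → ρ ⟨$⟩ʳ m′ , rows⇒edges (match m′))
  where
  rows⇒edges = λ {m} {m′} → Equivalence.to (rows⇔edges σ π τ m m′)

EdgeSetsMatch⇒RowsMatch : ∀ (σ : Permutation′ N) π τ → EdgeSetsMatch σ π τ → ∃[ ρ ] RowsMatch σ ρ π τ
EdgeSetsMatch⇒RowsMatch {N} σ π τ (π-edges , τ-edges) = Perm.permutation g f g∘f f∘g , g-rows
  where
  edges⇒rows = λ {m} {m′} → Equivalence.from (rows⇔edges σ π τ m m′)
  f g : Fin N → Fin N
  f m  = proj₁ (π-edges m)
  g m′ = proj₁ (τ-edges m′)
  f-rows : ∀ m j → stepMatrix π m j ≡ stepMatrix τ (f m) (σ ⟨$⟩ʳ j)
  f-rows m = edges⇒rows (proj₂ (π-edges m))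
  g-rows : ∀ m′ j → stepMatrix π (g m′) j ≡ stepMatrix τ m′ (σ ⟨$⟩ʳ j)
  g-rows m′ = edges⇒rows (proj₂ (τ-edges m′))
  g∘f : ∀ m → g (f m) ≡ m
  g∘f m = stepMatrix-rows-distinct π (λ j → trans (g-rows (f m) j) (sym (f-rows m j)))
  f∘g : ∀ m′ → f (g m′) ≡ m′
  f∘g m′ = stepMatrix-rows-distinct τ λ k →
    subst (λ k → stepMatrix τ (f (g m′)) k ≡ stepMatrix τ m′ k) (Perm.inverseʳ σ)
      (trans (sym (f-rows (g m′) (σ ⟨$⟩ˡ k))) (g-rows m′ (σ ⟨$⟩ˡ k)))

transfer : Permutation′ (suc N) → Permutation′ (suc N) → Permutation′ N → Vector ℚ N → Vector ℚ N
transfer π τ ρ y = steps (Perm.flip τ) (λ m → steps π y (ρ ⟨$⟩ʳ m))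

transfer-isLinear : ∀ (π τ : Permutation′ (suc N)) ρ → IsLinear (transfer π τ ρ)
transfer-isLinear π τ ρ =
  ∘-isLinear (steps-isLinear (Perm.flip τ)) (∘-isLinear (reindex-isLinear ρ) (steps-isLinear π))

transfer-inverse : ∀ (π τ : Permutation′ (suc N)) ρ y → transfer τ π (Perm.flip ρ) (transfer π τ ρ y) ≗ y
transfer-inverse π τ ρ y k = begin
  steps (Perm.flip π) (λ m → steps τ (transfer π τ ρ y) (ρ ⟨$⟩ˡ m)) k
    ≡⟨ IsLinear.cong-≗ (steps-isLinear (Perm.flip π)) steps-τ-transfer≗steps-π k ⟩
  steps (Perm.flip π) (steps π y) k
    ≡⟨ steps-flip-steps π y k ⟩
  y k ∎
  where
  open ≡-Reasoning
  steps-τ-transfer≗steps-π : (λ m → steps τ (transfer π τ ρ y) (ρ ⟨$⟩ˡ m)) ≗ steps π y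
  steps-τ-transfer≗steps-π m =
    trans (steps-steps-flip τ _ (ρ ⟨$⟩ˡ m)) (cong (steps π y) (Perm.inverseʳ ρ))

pattern-equivalence⇒orthantAutomorphism : ∀ (π τ : Permutation′ (suc N)) ρ →
  (∀ x → (x has-pattern π) ⇔ ((λ m → x (ρ ⟨$⟩ʳ m)) has-pattern τ)) →
  OrthantAutomorphism (transfer π τ ρ) (transfer τ π (Perm.flip ρ))
pattern-equivalence⇒orthantAutomorphism π τ ρ hρ = record
  { Φ-linear   = transfer-isLinear π τ ρ
  ; Ψ-linear   = transfer-isLinear τ π (Perm.flip ρ)
  ; Φ-positive = λ y 0<y → has-pattern⇒positive τ (Equivalence.to (hρ (steps π y)) (steps-has-pattern π 0<y))
  ; Ψ-positive = λ y 0<y → has-pattern⇒positive π (Equivalence.from (hρ (λ m → steps τ y (ρ ⟨$⟩ˡ m)))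
                   (has-pattern-cong τ (λ m → cong (steps τ y) (sym (Perm.inverseˡ ρ))) (steps-has-pattern τ 0<y)))
  ; Ψ∘Φ≗id     = transfer-inverse π τ ρ
  ; Φ∘Ψ≗id     = transfer-inverse τ π (Perm.flip ρ)
  }

transfer-monomial⇒rows-proportional : ∀ (π τ : Permutation′ (suc N)) ρ j k c →
  transfer π τ ρ (e j) ≗ c ·ᵥ e k → ∀ m → stepMatrix π (ρ ⟨$⟩ʳ m) j ≡ c * stepMatrix τ m k
transfer-monomial⇒rows-proportional π τ ρ j k c transfer-ej≗c·ek m = begin
  stepMatrix π (ρ ⟨$⟩ʳ m) j         ≡⟨ steps-unit π j (ρ ⟨$⟩ʳ m) ⟨
  steps π (e j) (ρ ⟨$⟩ʳ m)          ≡⟨ steps-steps-flip τ (λ m → steps π (e j) (ρ ⟨$⟩ʳ m)) m ⟨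
  steps τ (transfer π τ ρ (e j)) m  ≡⟨ cong-≗ transfer-ej≗c·ek m ⟩
  steps τ (c ·ᵥ e k) m              ≡⟨ homogeneous c (e k) m ⟩
  c * steps τ (e k) m               ≡⟨ cong (c *_) (steps-unit τ k m) ⟩
  c * stepMatrix τ m k              ∎
  where
  open ≡-Reasoning
  open IsLinear (steps-isLinear τ)

-- Column j of stepMatrix π has an entry ±1, which is c times an entry 0 or ±1 of stepMatrix τ.
rows-proportional⇒equal : ∀ (π τ : Permutation′ (suc N)) ρ j k {c} → 0ℚ < c →
  (∀ m → stepMatrix π (ρ ⟨$⟩ʳ m) j ≡ c * stepMatrix τ m k) → ∀ m → stepMatrix π (ρ ⟨$⟩ʳ m) j ≡ stepMatrix τ m k
rows-proportional⇒equal π τ ρ j k {c} 0<c proportional m =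
  trans (proportional m) (trans (cong (_* stepMatrix τ m k) (by-cases (S? τ m₁ k))) (ℚP.*-identityˡ _))
  where
  m₀ m₁ : Fin _
  m₀ = proj₁ (stepMatrix-column≢0 π j)
  m₁ = ρ ⟨$⟩ˡ m₀
  π-entry≢0 : stepMatrix π m₀ j ≢ 0ℚ
  π-entry≢0 = proj₂ (stepMatrix-column≢0 π j)
  π-entry≡c*τ-entry : stepMatrix π m₀ j ≡ c * stepMatrix τ m₁ k
  π-entry≡c*τ-entry = trans (cong (λ m → stepMatrix π m j) (sym (Perm.inverseʳ ρ))) (proportional m₁)
  by-cases : Dec (S τ m₁ k) → c ≡ 1ℚ
  by-cases (yes k∈S) = signℚ≡c*signℚ⇒c≡1 (ε π m₀) (ε τ m₁) 0<c (begin
    signℚ (ε π m₀)          ≡⟨ stepMatrix-inside π m₀ (Equivalence.from (S⇔stepMatrix≢0 π m₀ j) π-entry≢0) ⟨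
    stepMatrix π m₀ j       ≡⟨ π-entry≡c*τ-entry ⟩
    c * stepMatrix τ m₁ k   ≡⟨ cong (c *_) (stepMatrix-inside τ m₁ k∈S) ⟩
    c * signℚ (ε τ m₁)      ∎)
    where open ≡-Reasoning
  by-cases (no k∉S) =
    ⊥-elim (π-entry≢0 (trans π-entry≡c*τ-entry (trans (cong (c *_) (stepMatrix-outside τ m₁ k∉S)) (ℚP.*-zeroʳ c))))

∼⇒RowsMatch : ∀ (π τ : Permutation′ (suc N)) (π∼τ : π ∼ τ) → ∃[ σ ] RowsMatch σ (proj₁ π∼τ) π τ
∼⇒RowsMatch π τ (ρ , hρ) = σ , λ m j →
  let c , 0<c , transfer-ej≗c·eσj = proj₂ monomial j
  in rows-proportional⇒equal π τ ρ j (σ ⟨$⟩ʳ j) 0<c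
       (transfer-monomial⇒rows-proportional π τ ρ j (σ ⟨$⟩ʳ j) c transfer-ej≗c·eσj) m
  where
  monomial : ∃[ σ ] ∀ j → ∃[ c ] 0ℚ < c × transfer π τ ρ (e j) ≗ c ·ᵥ e (σ ⟨$⟩ʳ j)
  monomial = orthantAutomorphism⇒monomial (pattern-equivalence⇒orthantAutomorphism π τ ρ hρ)
  σ = proj₁ monomial

lemma2p4 : (N : ℕ) → 1 ≤ N → (π τ : Permutation′ (suc N)) →
    (π ∼ τ) ⇔ (∃[ σ ] EdgeSetsMatch {N} σ π τ)
lemma2p4 N _ π τ = mk⇔
  (λ π∼τ@(ρ , _) → let σ , rows-match = ∼⇒RowsMatch π τ π∼τ
                    in σ , RowsMatch⇒EdgeSetsMatch σ ρ π τ rows-match)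
  (λ (σ , edges-match) → let ρ , rows-match = EdgeSetsMatch⇒RowsMatch σ π τ edges-match
                         in RowsMatch⇒∼ σ ρ π τ rows-match)
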